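{- Let $G$ be a graph with no induced subgraph isomorphic to $C_5$, the bull, the gem, or the co-gem, and let $r\in\mathbb{N}\cup\{\infty\}$. Then the radius-$r$ flip-width of $G$ is at most $2$.
   Context: $\mathbb{N}$ is the set of positive integers. All graphs are finite, simple. For $A,B\subseteq V(G)$, $G\oplus(A,B)$ is the graph on $V(G)$ in which the adjacency of distinct $u,v$ is toggled exactly when $(u,v)\in(A\times B)\cup(B\times A)$; $G\oplus\mathcal{S}$ applies all flips in a collection $\mathcal{S}$. For a partition $\mathcal{P}$ of $V(G)$, a $\mathcal{P}$-flip is $G\oplus\mathcal{S}$ with all pairs in $\mathcal{S}$ of the form $(X,Y)$, $X,Y\in\mathcal{P}$; a $k$-flip is a $\mathcal{P}$-flip with $|\mathcal{P}|\le k$. Flipper game of radius $r\in\mathbb{N}\cup\{\infty\}$ and width $k$: $G_0=G$, the runner picks $v_0$; in round $i\ge1$ the flipper announces a $k$-flip $G_i$ of $G$, then the runner (knowing $G_i$) moves to $v_i$ reachable from $v_{i-1}$ by a path of length at most $r$ in $G_{i-1}$ (any vertex of the same component if $r=\infty$). The flipper wins when the runner's position $v_i$ is isolated in $G_i$. The radius-$r$ flip-width is the minimum $k$ such that the flipper has a winning strategy. $C_5$ is the 5-cycle; with $abcd$ an induced path and a fifth vertex $v$: the bull has $v$ adjacent exactly to $b,c$; the gem has $v$ adjacent to all of $a,b,c,d$; the co-gem has $v$ isolated. -}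

module Defs where

open import Data.Nat using (ℕ; zero; suc; _≤_)
open import Data.Fin using (Fin; zero; suc; _≟_)
open import Data.Bool using (Bool; true; false; _xor_; _∧_; _∨_; not; if_then_else_)
open import Data.List using (List; []; _∷_; foldr)
open import Data.Bool.ListAction using (any)
open import Data.Product using (Σ; _×_; _,_; ∃)
open import Data.Sum using (_⊎_)
open import Relation.Nullary using (¬_)
open import Relation.Nullary.Decidable using (⌊_⌋)
open import Relation.Binary.PropositionalEquality using (_≡_; _≢_)
open import Function.Definitions using (Injective)

record Graph (n : ℕ) : Set where
  field
    adj    : Fin n → Fin n → Bool
    sym    : ∀ u v → adj u v ≡ adj v u
    irrefl : ∀ v → adj v v ≡ false
open Graph public

Adj : ℕ → Set
Adj n = Fin n → Fin n → Bool

fromEdges : List (Fin 5 × Fin 5) → Adj 5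
fromEdges es i j = any (λ { (x , y) → (⌊ i ≟ x ⌋ ∧ ⌊ j ≟ y ⌋) ∨ (⌊ i ≟ y ⌋ ∧ ⌊ j ≟ x ⌋) }) es

-- vertex names: a = 0, b = 1, c = 2, d = 3, v = 4; abcd is an induced path.
a b c d v : Fin 5
a = zero
b = suc zero
c = suc (suc zero)
d = suc (suc (suc zero))
v = suc (suc (suc (suc zero)))

C5 : Adj 5
C5 = fromEdges ((a , b) ∷ (b , c) ∷ (c , d) ∷ (d , v) ∷ (v , a) ∷ [])

Bull : Adj 5
Bull = fromEdges ((a , b) ∷ (b , c) ∷ (c , d) ∷ (v , b) ∷ (v , c) ∷ [])

Gem : Adj 5
Gem = fromEdges ((a , b) ∷ (b , c) ∷ (c , d) ∷ (v , a) ∷ (v , b) ∷ (v , c) ∷ (v , d) ∷ [])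

CoGem : Adj 5
CoGem = fromEdges ((a , b) ∷ (b , c) ∷ (c , d) ∷ [])

HasInduced : ∀ {n} → Graph n → Adj 5 → Set
HasInduced G H = Σ (Fin 5 → Fin _) λ f →
  Injective _≡_ _≡_ f × (∀ i j → i ≢ j → adj G (f i) (f j) ≡ H i j)

-- A partition of Fin n into at most k parts is given by a map to Fin k
-- (parts = nonempty fibres).  A collection of flips is a list of pairs of parts.
-- G ⊕ S: the adjacency of distinct u, w is toggled once for every flip (X , Y)
-- in S with (u , w) ∈ X × Y ∪ Y × X.
flipAdj : ∀ {n k} → Graph n → (Fin n → Fin k) → List (Fin k × Fin k) → Adj n
flipAdj G p S u w =
  if ⌊ u ≟ w ⌋ then false
  else foldr (λ { (X , Y) acc →
         acc xor ((⌊ p u ≟ X ⌋ ∧ ⌊ p w ≟ Y ⌋) ∨ (⌊ p u ≟ Y ⌋ ∧ ⌊ p w ≟ X ⌋)) })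
       (adj G u w) S

data Radius : Set where
  fin : ℕ → Radius
  ∞   : Radius

-- r ∈ ℕ (positive integers) ∪ {∞}
PositiveRadius : Radius → Set
PositiveRadius (fin r) = 1 ≤ r
PositiveRadius ∞       = Data.Unit.⊤
  where import Data.Unit

data Walk {n : ℕ} (H : Adj n) : Fin n → Fin n → ℕ → Set where
  here : ∀ {u} → Walk H u u 0
  step : ∀ {u x w ℓ} → H u x ≡ true → Walk H x w ℓ → Walk H u w (suc ℓ)

Reach : ∀ {n} → Adj n → Radius → Fin n → Fin n → Set
Reach H (fin r) u w = Σ ℕ λ ℓ → ℓ ≤ r × Walk H u w ℓ
Reach H ∞       u w = Σ ℕ λ ℓ → Walk H u w ℓ

Isolated : ∀ {n} → Adj n → Fin n → Set
Isolated H u = ∀ w → w ≢ u → H u w ≡ false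

-- Flipper game of radius r and width k on G.
-- FlipperWins G r k Hprev u : the flipper has a strategy that wins (in finitely
-- many rounds) from the position where the previous graph is Hprev and the runner
-- stands on u.  The flipper announces a k-flip H of G; the runner moves to any w
-- reachable from u within distance r in Hprev; the flipper has won if w is
-- isolated in H, otherwise play continues from (H , w).
data FlipperWins {n : ℕ} (G : Graph n) (r : Radius) (k : ℕ) : Adj n → Fin n → Set where
  announce : ∀ {Hprev u} (p : Fin n → Fin k) (S : List (Fin k × Fin k)) →
    (∀ w → Reach Hprev r u w →
       Isolated (flipAdj G p S) w ⊎ FlipperWins G r k (flipAdj G p S) w) →
    FlipperWins G r k Hprev u

-- The flipper has a winning strategy in the game of radius r and width k
-- (G_0 = G, the runner picks v_0 arbitrarily).
FlipperHasWinningStrategy : ∀ {n} → Graph n → Radius → ℕ → Set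
FlipperHasWinningStrategy G r k = ∀ v₀ → FlipperWins G r k (adj G) v₀

-- radius-r flip-width of G is at most m: the minimum winning width is ≤ m.
FlipWidth≤ : ∀ {n} → Graph n → Radius → ℕ → Set
FlipWidth≤ G r m = Σ ℕ λ k → k ≤ m × FlipperHasWinningStrategy G r k

{-# OPTIONS --safe #-}

-- C₅, the bull, the gem and the co-gem form the switching class of P₄ + K₁.
-- Hence switching G along the neighbourhood σ of a vertex gives a cograph C:
-- that vertex becomes isolated, so a P₄ of C would yield a switched co-gem in G.
--
-- A module D of C is, in G, one side of a bi-join, so a single 2-flip cuts D off
-- from the rest while turning G[D] into C[D] or into its complement, as the
-- flipper likes.  As C[D] is a cograph, D is a single vertex or one of the two
-- is disconnected.  Announcing that one confines the runner to a smaller module.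
module Submission where

open import Defs
open import Data.Nat using (ℕ; _<_)
open import Data.Nat.Properties using (≤-refl)
open import Data.Nat.Induction using (<-wellFounded)
open import Induction.WellFounded using (Acc; acc)
open import Data.Bool using (Bool; true; false; not; _xor_; _∧_; _∨_; if_then_else_)
open import Data.Bool.Properties
  using (not-¬; ¬-not; not-involutive; xor-assoc; xor-comm; xor-same; xor-identityʳ)
  renaming (_≟_ to _≟ᵇ_)
open import Data.Bool.Solver using (module xor-∧-Solver)
open import Data.Empty using (⊥; ⊥-elim)
open import Data.Fin using (Fin; zero; suc)
open import Data.Fin.Patterns using (0F; 1F; 2F; 3F; 4F)
open import Data.Fin.Properties using (all?) renaming (_≟_ to _≟ᶠ_)
open import Data.List using (List; []; _∷_; length; filter; allFin)
open import Data.List.Properties using (filter-notAll)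
open import Data.List.Membership.Propositional using (_∈_; _∉_; lose; find)
open import Data.List.Membership.Propositional.Properties
  using (∈-filter⁺; ∈-filter⁻; ∈-allFin)
open import Data.List.Relation.Unary.All.Properties using (All¬⇒¬Any)
open import Data.List.Relation.Unary.Any using (any?; here; there)
open import Data.List.Relation.Unary.AllPairs using (_∷_)
open import Data.List.Relation.Unary.Unique.Propositional using (Unique)
open import Data.List.Relation.Unary.Unique.Propositional.Properties
  using (allFin⁺; filter⁺)
open import Data.Product using (_×_; _,_; ∃)
open import Data.Sum using (_⊎_; inj₁; inj₂)
open import Data.Vec using (Vec; []; _∷_; lookup)
open import Function using (_∘_; const)
open import Relation.Binary.Definitions using (DecidableEquality)
open import Relation.Binary.PropositionalEquality as ≡
  using (_≡_; _≢_; refl; trans; cong; cong₂)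
open import Relation.Nullary using (¬_; Dec; yes; no; does; contradiction)
open import Relation.Nullary.Decidable using (⌊_⌋; True; toWitness; from-yes; _→-dec_)

-- Cographs and their decomposition.

P₄-Free : ∀ {A : Set} → (A → A → Bool) → Set
P₄-Free C = ∀ {x y z w} → C x y ≡ true → C y z ≡ true → C z w ≡ true →
  C x z ≡ false → C x w ≡ false → C y w ≡ false → ⊥

module Cograph {A : Set} (_≟_ : DecidableEquality A) (C : A → A → Bool)
  (C-sym : ∀ x y → C x y ≡ C y x) (p₄-free : P₄-Free C) where

  -- The complement of a P₄ is again a P₄: for `γ = false` the path runs `y`, `w`, `x`, `z`.
  no-P₄ : ∀ γ {x y z w} → C x y ≡ γ → C y z ≡ γ → C z w ≡ γ →
    C x z ≡ not γ → C x w ≡ not γ → C y w ≡ not γ → ⊥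
  no-P₄ true = p₄-free
  no-P₄ false xy yz zw xz xw yw =
    p₄-free yw (trans (C-sym _ _) xw) xz (trans (C-sym _ _) xy) yz (trans (C-sym _ _) zw)

  -- A disjoint union (`colour = false`) or a join (`colour = true`); keeping the colour as a
  -- parameter treats both at once.
  record Splitting (xs : List A) : Set where
    field
      side        : A → Bool
      colour      : Bool
      inhabited   : ∀ s → ∃ λ x → x ∈ xs × side x ≡ s
      homogeneous : ∀ {x y} → x ∈ xs → y ∈ xs → side x ≢ side y → C x y ≡ colour

  attach : ∀ {x xs} → x ∉ xs → ∀ s β (side : A → Bool) →
    (∃ λ y → y ∈ xs × side y ≡ not s) →
    (∀ {y} → y ∈ xs → side y ≡ not s → C x y ≡ β) →
    (∀ {y z} → y ∈ xs → z ∈ xs → side y ≢ side z → C y z ≡ β) →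
    Splitting (x ∷ xs)
  attach {x} {xs} x∉xs s β side (o , o∈xs , o-side) at-x on-xs = record
    { side = side′ ; colour = β ; inhabited = inhabited′ ; homogeneous = homogeneous′ }
    where
    side′ : A → Bool
    side′ y = if does (y ≟ x) then s else side y

    side′-x : side′ x ≡ s
    side′-x with x ≟ x
    ... | yes _   = refl
    ... | no x≢x = contradiction refl x≢x

    side′-xs : ∀ {y} → y ∈ xs → side′ y ≡ side y
    side′-xs {y} y∈xs with y ≟ x
    ... | yes refl = contradiction y∈xs x∉xs
    ... | no _     = refl

    inhabited′ : ∀ s′ → ∃ λ y → y ∈ x ∷ xs × side′ y ≡ s′
    inhabited′ s′ with s′ ≟ᵇ s
    ... | yes refl = x , here refl , side′-x
    ... | no s′≢s  = o , there o∈xs ,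
      trans (side′-xs o∈xs) (trans o-side (≡.sym (¬-not s′≢s)))

    opposite : ∀ {y} → y ∈ xs → side′ y ≢ side′ x → C x y ≡ β
    opposite y∈xs ne = at-x y∈xs
      (trans (≡.sym (side′-xs y∈xs)) (trans (¬-not ne) (cong not side′-x)))

    homogeneous′ : ∀ {y z} → y ∈ x ∷ xs → z ∈ x ∷ xs → side′ y ≢ side′ z → C y z ≡ β
    homogeneous′ (here refl) (here refl) ne = contradiction refl ne
    homogeneous′ (here refl) (there z∈)  ne = opposite z∈ (ne ∘ ≡.sym)
    homogeneous′ (there y∈)  (here refl) ne = trans (C-sym _ _) (opposite y∈ ne)
    homogeneous′ (there y∈)  (there z∈)  ne = on-xs y∈ z∈
      λ eq → ne (trans (side′-xs y∈) (trans eq (≡.sym (side′-xs z∈))))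

  attach-homogeneous : ∀ {x y xs} → x ∉ y ∷ xs → ∀ γ →
    (∀ {z} → z ∈ y ∷ xs → C x z ≡ γ) → Splitting (x ∷ y ∷ xs)
  attach-homogeneous x∉ γ x-γ = attach x∉ false γ (const true)
    (_ , here refl , refl) (λ z∈ _ → x-γ z∈) (λ _ _ ne → contradiction refl ne)

  -- If x has a γ-neighbour on each side, γ being the colour not used between the
  -- sides, then a pair of colour γ between a γ-neighbour and a γ-nonneighbour of x
  -- would extend through x to a P₄ ending on the other side.
  extend : ∀ {x y xs} → x ∉ y ∷ xs → Splitting (y ∷ xs) → Splitting (x ∷ y ∷ xs)
  extend {x} {y} {xs} x∉ S = by-neighbours (neighbour? true) (neighbour? false)
    where
    open Splitting S
    ys = y ∷ xs
    γ = not colour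

    Neighbour : Bool → Set
    Neighbour s = ∃ λ z → z ∈ ys × side z ≡ s × C x z ≡ γ

    neighbour? : ∀ s → Neighbour s ⊎ (∀ {z} → z ∈ ys → side z ≡ s → C x z ≡ colour)
    neighbour? s with any? (λ z → C x z ≟ᵇ γ) (filter (λ z → side z ≟ᵇ s) ys)
    ... | yes p = let z , z∈ , xz = find p
                      z∈ys , z-s = ∈-filter⁻ (λ z → side z ≟ᵇ s) z∈
                  in inj₁ (z , z∈ys , z-s , xz)
    ... | no ¬p = inj₂ λ z∈ z-s → trans
      (¬-not (λ xz → ¬p (lose (∈-filter⁺ (λ z → side z ≟ᵇ s) z∈ z-s) xz)))
      (not-involutive colour)

    no-edge : (∀ s → Neighbour s) → ∀ {u w} → u ∈ ys → w ∈ ys →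
      C x u ≡ colour → C x w ≡ γ → C u w ≡ colour
    no-edge nbr {u} {w} u∈ w∈ xu xw with C u w ≟ᵇ colour | side u ≟ᵇ side w
    ... | yes uw | _     = uw
    ... | no _   | no ne = homogeneous u∈ w∈ ne
    ... | no uw  | yes eq with f , f∈ , f-side , xf ← nbr (not (side w)) =
      ⊥-elim
        (no-P₄ γ (¬-not uw) (trans (C-sym _ _) xw) xf
          (¬γ (trans (C-sym _ _) xu))
          (¬γ (homogeneous u∈ f∈ λ e → not-¬ eq (trans e f-side)))
          (¬γ (homogeneous w∈ f∈ λ e → not-¬ {side w} refl (trans e f-side))))
      where
      ¬γ : ∀ {s} → s ≡ colour → s ≡ not γ
      ¬γ e = trans e (≡.sym (not-involutive colour))

    by-neighbours :
      Neighbour true ⊎ (∀ {z} → z ∈ ys → side z ≡ true → C x z ≡ colour) →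
      Neighbour false ⊎ (∀ {z} → z ∈ ys → side z ≡ false → C x z ≡ colour) →
      Splitting (x ∷ ys)
    by-neighbours (inj₂ none) _ =
      attach x∉ false colour side (inhabited true) none homogeneous
    by-neighbours _ (inj₂ none) =
      attach x∉ true colour side (inhabited false) none homogeneous
    -- The old sides are given up. If `x` has colour `γ` to everything, it is split off alone;
    -- otherwise the new sides are the fibres of `C x`, with `x` placed among its `γ`-neighbours.
    by-neighbours (inj₁ nᵗ) (inj₁ nᶠ) with any? (λ z → C x z ≟ᵇ colour) ys
    ... | no ¬p = attach-homogeneous x∉ γ λ z∈ → ¬-not λ xz → ¬p (lose z∈ xz)
    ... | yes p with n , n∈ , xn ← find p =
      attach x∉ γ colour (C x) (n , n∈ , trans xn (≡.sym (not-involutive colour)))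
        (λ _ xz → trans xz (not-involutive colour)) cross
      where
      nbr : ∀ s → Neighbour s
      nbr true  = nᵗ
      nbr false = nᶠ

      cross : ∀ {u w} → u ∈ ys → w ∈ ys → C x u ≢ C x w → C u w ≡ colour
      cross {u} {w} u∈ w∈ ne with C x u ≟ᵇ colour
      ... | yes xu = no-edge nbr u∈ w∈ xu (¬-not λ xw → ne (trans xu (≡.sym xw)))
      ... | no xu  = trans (C-sym _ _) (no-edge nbr w∈ u∈ xw (¬-not xu))
        where
        xw : C x w ≡ colour
        xw = trans (¬-not (ne ∘ ≡.sym)) (trans (cong not (¬-not xu)) (not-involutive colour))

  -- Vertices are added one at a time, starting from two, whose only pair fixes the colour.
  split : ∀ {x y xs} → Unique (x ∷ y ∷ xs) → Splitting (x ∷ y ∷ xs)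
  split {x} {y} {[]} (x∉ ∷ _) =
    attach-homogeneous (All¬⇒¬Any x∉) (C x y) λ { (here refl) → refl }
  split {xs = _ ∷ _} (x∉ ∷ unique) = extend (All¬⇒¬Any x∉) (split unique)

-- Flips with two parts, and switching.

part : Bool → Fin 2
part false = zero
part true  = suc zero

-- Passing from one collection to the other complements the flipped graph, which lets the flipper
-- choose between `C[D]` and its complement.
flips : Bool → List (Fin 2 × Fin 2)
flips false = (zero , suc zero) ∷ []
flips true  = (zero , zero) ∷ (suc zero , suc zero) ∷ []

between : Fin 2 → Fin 2 → Bool → Bool → Bool
between X Y s t = (⌊ part s ≟ᶠ X ⌋ ∧ ⌊ part t ≟ᶠ Y ⌋) ∨ (⌊ part s ≟ᶠ Y ⌋ ∧ ⌊ part t ≟ᶠ X ⌋)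

flips-across : ∀ s t → between zero (suc zero) s t ≡ s xor t
flips-across false false = refl
flips-across false true  = refl
flips-across true  false = refl
flips-across true  true  = refl

-- The order of the summands is that of `foldr` in `flipAdj`, which applies the last flip of a list
-- first.
flips-within : ∀ s t →
  between (suc zero) (suc zero) s t xor between zero zero s t ≡ true xor (s xor t)
flips-within false false = refl
flips-within false true  = refl
flips-within true  false = refl
flips-within true  true  = refl

flipAdj-flips : ∀ {n} (G : Graph n) (f : Fin n → Bool) β {u w} → u ≢ w →
  flipAdj G (part ∘ f) (flips β) u w ≡ adj G u w xor (β xor (f u xor f w))
flipAdj-flips G f β {u} {w} u≢w with u ≟ᶠ w
flipAdj-flips G f β     {u} {w} u≢w | yes u≡w = contradiction u≡w u≢w
flipAdj-flips G f false {u} {w} u≢w | no _ = cong (adj G u w xor_) (flips-across (f u) (f w))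
flipAdj-flips G f true  {u} {w} u≢w | no _ = trans (xor-assoc (adj G u w) _ _)
  (cong (adj G u w xor_) (flips-within (f u) (f w)))

switch : ∀ {n} → Adj n → (Fin n → Bool) → Adj n
switch H σ u w = H u w xor (σ u xor σ w)

switch-involutive : ∀ {n} (H : Adj n) σ u w → switch (switch H σ) σ u w ≡ H u w
switch-involutive H σ u w = trans (xor-assoc (H u w) _ _)
  (trans (cong (H u w xor_) (xor-same (σ u xor σ w))) (xor-identityʳ _))

-- The switching class of the co-gem.

TwinFree : ∀ {n} → Adj n → Set
TwinFree H = ∀ i j → (∀ k → H i k ≡ H j k) → i ≡ j

twinFree? : ∀ {n} (H : Adj n) → Dec (TwinFree H)
twinFree? H = all? λ i → all? λ j → all? (λ k → H i k ≟ᵇ H j k) →-dec (i ≟ᶠ j)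

-- Indices with the same image under `f` have equal rows in `H`, so twin-freeness supplies
-- injectivity.
twinFree⇒HasInduced : ∀ {n} (G : Graph n) {H} → TwinFree H → (f : Fin 5 → Fin n) →
  (∀ i j → adj G (f i) (f j) ≡ H i j) → HasInduced G H
twinFree⇒HasInduced G tf f eq = f
  , (λ {i} {j} fi≡fj → tf i j λ k →
      trans (≡.sym (eq i k)) (trans (cong (λ x → adj G x (f k)) fi≡fj) (eq j k)))
  , λ i j _ → eq i j

record _≼_ (H K : Adj 5) : Set where
  constructor _,_
  field
    image     : Fin 5 → Fin 5
    preserves : ∀ i j → K (image i) (image j) ≡ H i j

embed : ∀ {H K} (π : Vec (Fin 5) 5) →
  {True (all? λ i → all? λ j → K (lookup π i) (lookup π j) ≟ᵇ H i j)} → H ≼ K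
embed π {ok} = lookup π , toWitness ok

-- The last entry is `false` because `v` stands for the vertex whose neighbourhood is switched,
-- which is not its own neighbour.
at : (p q s t : Bool) → Fin 5 → Bool
at p q s t = lookup (p ∷ q ∷ s ∷ t ∷ false ∷ [])

data Obstruction (K : Adj 5) : Set where
  c5    : C5    ≼ K → Obstruction K
  bull  : Bull  ≼ K → Obstruction K
  gem   : Gem   ≼ K → Obstruction K
  cogem : CoGem ≼ K → Obstruction K

-- Complementary sets give the same switching, so the 16 sets avoiding `v` exhaust the class: `C5`
-- arises once, each other graph five times. Each vector lists the images of `a`, `b`, `c`, `d`, `v`
-- and is checked by evaluation.
switched-coGem : ∀ p q s t → Obstruction (switch CoGem (at p q s t))
switched-coGem false false false false = cogem (embed (a ∷ b ∷ c ∷ d ∷ v ∷ []))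
switched-coGem false false false true  = bull  (embed (c ∷ b ∷ d ∷ v ∷ a ∷ []))
switched-coGem false false true  false = cogem (embed (b ∷ a ∷ c ∷ v ∷ d ∷ []))
switched-coGem false false true  true  = gem   (embed (b ∷ a ∷ c ∷ v ∷ d ∷ []))
switched-coGem false true  false false = cogem (embed (c ∷ d ∷ b ∷ v ∷ a ∷ []))
switched-coGem false true  false true  = cogem (embed (a ∷ d ∷ v ∷ b ∷ c ∷ []))
switched-coGem false true  true  false = bull  (embed (a ∷ c ∷ b ∷ d ∷ v ∷ []))
switched-coGem false true  true  true  = gem   (embed (a ∷ d ∷ v ∷ b ∷ c ∷ []))
switched-coGem true  false false false = bull  (embed (b ∷ c ∷ a ∷ v ∷ d ∷ []))
switched-coGem true  false false true  = c5    (embed (a ∷ c ∷ b ∷ d ∷ v ∷ []))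
switched-coGem true  false true  false = cogem (embed (c ∷ v ∷ a ∷ d ∷ b ∷ []))
switched-coGem true  false true  true  = bull  (embed (a ∷ v ∷ d ∷ b ∷ c ∷ []))
switched-coGem true  true  false false = gem   (embed (c ∷ d ∷ b ∷ v ∷ a ∷ []))
switched-coGem true  true  false true  = bull  (embed (c ∷ a ∷ v ∷ d ∷ b ∷ []))
switched-coGem true  true  true  false = gem   (embed (c ∷ v ∷ a ∷ d ∷ b ∷ []))
switched-coGem true  true  true  true  = gem   (embed (a ∷ b ∷ c ∷ d ∷ v ∷ []))

-- Switching at a vertex yields a cograph.

module Switching {n : ℕ} (G : Graph n) (v₀ : Fin n) where

  σ : Fin n → Bool
  σ = adj G v₀

  C : Adj n
  C = switch (adj G) σ

  C-sym : ∀ u w → C u w ≡ C w u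
  C-sym u w = cong₂ _xor_ (Graph.sym G u w) (xor-comm (σ u) (σ w))

  C-irrefl : ∀ u → C u u ≡ false
  C-irrefl u = cong₂ _xor_ (irrefl G u) (xor-same (σ u))

  C-isolated : ∀ u → C v₀ u ≡ false
  C-isolated u = trans (cong (λ s → σ u xor (s xor σ u)) (irrefl G v₀)) (xor-same (σ u))

  module _ (¬c5 : ¬ HasInduced G C5) (¬bull : ¬ HasInduced G Bull)
    (¬gem : ¬ HasInduced G Gem) (¬cogem : ¬ HasInduced G CoGem) where

    C-P₄-free : P₄-Free C
    C-P₄-free {x} {y} {z} {w} xy yz zw xz xw yw =
      refute (switched-coGem (σ x) (σ y) (σ z) (σ w))
      where
      f : Fin 5 → Fin n
      f = lookup (x ∷ y ∷ z ∷ w ∷ v₀ ∷ [])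

      flip : ∀ {u u′ s} → C u u′ ≡ s → C u′ u ≡ s
      flip = trans (C-sym _ _)

      -- Diagonal pairs count too: injectivity is deduced later from agreement on all pairs.
      C-f : ∀ i j → C (f i) (f j) ≡ CoGem i j
      C-f 0F 0F = C-irrefl _
      C-f 0F 1F = xy
      C-f 0F 2F = xz
      C-f 0F 3F = xw
      C-f 0F 4F = flip (C-isolated _)
      C-f 1F 0F = flip xy
      C-f 1F 1F = C-irrefl _
      C-f 1F 2F = yz
      C-f 1F 3F = yw
      C-f 1F 4F = flip (C-isolated _)
      C-f 2F 0F = flip xz
      C-f 2F 1F = flip yz
      C-f 2F 2F = C-irrefl _
      C-f 2F 3F = zw
      C-f 2F 4F = flip (C-isolated _)
      C-f 3F 0F = flip xw
      C-f 3F 1F = flip yw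
      C-f 3F 2F = flip zw
      C-f 3F 3F = C-irrefl _
      C-f 3F 4F = flip (C-isolated _)
      C-f 4F 0F = C-isolated _
      C-f 4F 1F = C-isolated _
      C-f 4F 2F = C-isolated _
      C-f 4F 3F = C-isolated _
      C-f 4F 4F = C-isolated _

      σ-f : ∀ i → σ (f i) ≡ at (σ x) (σ y) (σ z) (σ w) i
      σ-f 0F = refl
      σ-f 1F = refl
      σ-f 2F = refl
      σ-f 3F = refl
      σ-f 4F = irrefl G v₀

      adj-f : ∀ i j → adj G (f i) (f j) ≡ switch CoGem (at (σ x) (σ y) (σ z) (σ w)) i j
      adj-f i j = trans (≡.sym (switch-involutive (adj G) σ (f i) (f j)))
        (cong₂ _xor_ (C-f i j) (cong₂ _xor_ (σ-f i) (σ-f j)))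

      induced : ∀ {H} → TwinFree H → H ≼ switch CoGem (at (σ x) (σ y) (σ z) (σ w)) →
        HasInduced G H
      induced tf (π , eq) = twinFree⇒HasInduced G tf (f ∘ π)
        λ i j → trans (adj-f (π i) (π j)) (eq i j)

      refute : Obstruction (switch CoGem (at (σ x) (σ y) (σ z) (σ w))) → ⊥
      refute (c5 e)    = ¬c5 (induced (from-yes (twinFree? C5)) e)
      refute (bull e)  = ¬bull (induced (from-yes (twinFree? Bull)) e)
      refute (gem e)   = ¬gem (induced (from-yes (twinFree? Gem)) e)
      refute (cogem e) = ¬cogem (induced (from-yes (twinFree? CoGem)) e)

-- Closed modules and the flipper's strategy.

Closed : ∀ {n} → Adj n → List (Fin n) → Set
Closed H D = ∀ {u w} → u ∈ D → H u w ≡ true → w ∈ D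

walk-closed : ∀ {n} {H : Adj n} {D u w ℓ} → Closed H D → Walk H u w ℓ → u ∈ D → w ∈ D
walk-closed cl here        u∈ = u∈
walk-closed cl (step e wk) u∈ = walk-closed cl wk (cl u∈ e)

-- No walk leaves a closed set, however long it is; this is why one strategy serves every radius.
reach-closed : ∀ {n} {H : Adj n} {D} r {u w} → Closed H D → Reach H r u w → u ∈ D → w ∈ D
reach-closed (fin _) cl (_ , _ , wk) = walk-closed cl wk
reach-closed ∞       cl (_ , wk)     = walk-closed cl wk

module Strategy {n : ℕ} (G : Graph n) (σ : Fin n → Bool)
  (C-sym : ∀ u w → switch (adj G) σ u w ≡ switch (adj G) σ w u)
  (C-P₄-free : P₄-Free (switch (adj G) σ)) (r : Radius) where

  C : Adj n
  C = switch (adj G) σ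

  open Cograph _≟ᶠ_ C C-sym C-P₄-free
  open import Data.List.Membership.DecPropositional (_≟ᶠ_ {n}) using (_∈?_)

  -- `τ` is kept as data because the flip that cuts `D` off is built from it.
  Module : List (Fin n) → (Fin n → Bool) → Set
  Module D τ = ∀ {u w} → u ∈ D → w ∉ D → C u w ≡ τ w

  override : List (Fin n) → Bool → (Fin n → Bool) → Fin n → Bool
  override D s τ w = if does (w ∈? D) then s else τ w

  override-∈ : ∀ D s τ {w} → w ∈ D → override D s τ w ≡ s
  override-∈ D s τ {w} w∈ with w ∈? D
  ... | yes _  = refl
  ... | no w∉ = contradiction w∈ w∉

  override-∉ : ∀ D s τ {w} → w ∉ D → override D s τ w ≡ τ w
  override-∉ D s τ {w} w∉ with w ∈? D
  ... | yes w∈ = contradiction w∈ w∉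
  ... | no _   = refl

  module Isolate (D : List (Fin n)) (τ : Fin n → Bool) (isModule : Module D τ) (β : Bool) where

    -- A vertex of D and one outside D get the same value of σ xor ε iff their
    -- adjacency in G is β, so flipping across (β = false) or within (β = true) the
    -- two values deletes all edges leaving D.
    ε : Fin n → Bool
    ε = override D false λ w → τ w xor β

    ε-inside : ∀ {w} → w ∈ D → ε w ≡ false
    ε-inside = override-∈ D false (λ w → τ w xor β)

    ε-outside : ∀ {w} → w ∉ D → ε w ≡ τ w xor β
    ε-outside = override-∉ D false (λ w → τ w xor β)

    parts : Fin n → Fin 2
    parts w = part (σ w xor ε w)

    H : Adj n
    H = flipAdj G parts (flips β)

    -- The parts combine two switchings: the `σ` summand turns `G` into `C`, and the toggles by `ε`
    -- and `β` remain.
    H-C : ∀ {u w} → u ≢ w → H u w ≡ C u w xor (β xor (ε u xor ε w))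
    H-C {u} {w} u≢w = trans (flipAdj-flips G (λ x → σ x xor ε x) β u≢w)
      (solve 6 (λ g b s e s′ e′ → g :+ (b :+ ((s :+ e) :+ (s′ :+ e′)))
                                 := (g :+ (s :+ s′)) :+ (b :+ (e :+ e′)))
        refl (adj G u w) β (σ u) (ε u) (σ w) (ε w))
      where open xor-∧-Solver

    H-inside : ∀ {u w} → u ∈ D → w ∈ D → u ≢ w → H u w ≡ C u w xor β
    H-inside {u} {w} u∈ w∈ u≢w = trans (H-C u≢w)
      (cong (C u w xor_)
        (trans (cong₂ (λ s t → β xor (s xor t)) (ε-inside u∈) (ε-inside w∈)) (xor-identityʳ β)))

    -- The remaining toggle is `β xor (τ w xor β)`, that is `τ w`, which cancels `C u w`.
    H-outside : ∀ {u w} → u ∈ D → w ∉ D → H u w ≡ false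
    H-outside {u} {w} u∈ w∉ = trans (H-C λ { refl → w∉ u∈ })
      (trans (cong₂ (λ s t → s xor (β xor t)) (isModule u∈ w∉)
                    (cong₂ _xor_ (ε-inside u∈) (ε-outside w∉)))
             (solve 2 (λ t b → t :+ (b :+ (t :+ b)) := con false) refl (τ w) β))
      where open xor-∧-Solver

  -- Induction on the size of `D`. The runner moves in the previous graph, where `D` is closed, and
  -- so stays in `D`; the side of the splitting on which the move ends is the next, smaller module.
  wins : ∀ D → Acc _<_ (length D) → Unique D → ∀ τ → Module D τ →
    ∀ {H u} → Closed H D → u ∈ D → FlipperWins G r 2 H u
  -- Cutting off a single vertex already isolates it, so either value of `β` would do.
  wins (x ∷ []) _ _ τ isModule closed u∈ = announce parts (flips false)
    λ w reach → inj₁ (isolated (reach-closed r closed reach u∈))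
    where
    open Isolate (x ∷ []) τ isModule false
    isolated : ∀ {w} → w ∈ x ∷ [] → Isolated H w
    isolated (here refl) y y≢x = H-outside (here refl) λ { (here y≡x) → y≢x y≡x }
  wins (x ∷ y ∷ xs) (acc rec) unique τ isModule closed u∈ = announce parts (flips colour)
    λ w reach → let w∈ = reach-closed r closed reach u∈ in
      inj₂ (wins (class (side w)) (rec (class-< (side w))) (filter⁺ (in? (side w)) unique)
        τ′ (class-module (side w)) class-closed (∈-filter⁺ (in? (side w)) w∈ refl))
    where
    D = x ∷ y ∷ xs
    open Splitting (split unique)
    -- Pairs across the splitting have value `colour` in `C`; toggling by `β = colour` deletes them,
    -- which makes both sides closed.
    open Isolate D τ isModule colour

    in? : ∀ s z → Dec (side z ≡ s)
    in? s z = side z ≟ᵇ s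

    class : Bool → List (Fin n)
    class s = filter (in? s) D

    class-< : ∀ s → length (class s) < length D
    class-< s with z , z∈ , z-side ← inhabited (not s) =
      filter-notAll (in? s) D (lose z∈ λ eq → not-¬ eq z-side)

    -- A vertex of `D` outside a class lies on the other side and shows `colour` to the class, so
    -- one `τ′` fits both classes.
    τ′ : Fin n → Bool
    τ′ = override D colour τ

    class-module : ∀ s → Module (class s) τ′
    class-module s {u} {w} u∈s w∉s
      with u∈ , u-side ← ∈-filter⁻ (in? s) u∈s | w ∈? D
    ... | yes w∈ = trans
      (homogeneous u∈ w∈ λ eq → w∉s (∈-filter⁺ (in? s) w∈ (trans (≡.sym eq) u-side)))
      (≡.sym (override-∈ D colour τ w∈))
    ... | no w∉ = trans (isModule u∈ w∉) (≡.sym (override-∉ D colour τ w∉))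

    class-closed : ∀ {s} → Closed H (class s)
    class-closed {s} {u} {w} u∈s uw
      with u∈ , u-side ← ∈-filter⁻ (in? s) u∈s | w ∈? D | side w ≟ᵇ s
    ... | no w∉  | _      = contradiction (trans (≡.sym uw) (H-outside u∈ w∉)) λ ()
    ... | yes w∈ | yes eq = ∈-filter⁺ (in? s) w∈ eq
    ... | yes w∈ | no ne  = contradiction
      (trans (≡.sym uw) (trans (H-inside u∈ w∈ λ { refl → ne u-side })
        (trans (cong (_xor colour) (homogeneous u∈ w∈ λ eq → ne (trans (≡.sym eq) u-side)))
               (xor-same colour))))
      λ ()

theorem4p2 : ∀ {n : ℕ} (G : Graph n) →
    ¬ HasInduced G C5 → ¬ HasInduced G Bull → ¬ HasInduced G Gem → ¬ HasInduced G CoGem →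
    (r : Radius) → PositiveRadius r →
    FlipWidth≤ G r 2
theorem4p2 {n} G ¬c5 ¬bull ¬gem ¬cogem r _ = 2 , ≤-refl , strategy
  where
  strategy : FlipperHasWinningStrategy G r 2
  -- The whole vertex set is vacuously a module, so `τ` is arbitrary here. The runner's first vertex
  -- doubles as the vertex at which `G` is switched.
  strategy v₀ = wins (allFin n) (<-wellFounded _) (allFin⁺ n) (const false)
    (λ _ w∉ → contradiction (∈-allFin _) w∉) (λ _ _ → ∈-allFin _) (∈-allFin v₀)
    where
    open Switching G v₀
    open Strategy G σ C-sym (C-P₄-free ¬c5 ¬bull ¬gem ¬cogem) r using (wins)
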